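{- Let $G$ be a $\Delta$-regular graph on $n$ vertices. Every minimum maximal matching of $G$ leaves at most $\lfloor (\Delta-1)n/(2\Delta-1) \rfloor$ at-risk vertices, and if a minimum maximal matching leaves at most $2^\Delta - 1$ at-risk vertices, then $\gamma(G) \le \gamma_e(G)$. In particular, $\gamma(G) \le \gamma_e(G)$ for every $4$-regular graph on at most $37$ vertices, every $5$-regular graph on at most $70$ vertices, and every $6$-regular graph on at most $140$ vertices.
   Context: Graphs are finite, simple and undirected. A graph is $\Delta$-regular if every vertex has exactly $\Delta$ neighbours. The domination number $\gamma(G)$ is the minimum size of a set $S$ of vertices such that every vertex outside $S$ has a neighbour in $S$. A matching is a set of edges no two of which share a vertex; it is maximal if no edge of $G$ can be added to it. The edge domination number $\gamma_e(G)$ is the minimum size of a maximal matching, and a minimum maximal matching is a maximal matching of that size. Given a maximal matching $M$ of a $\Delta$-regular graph, a vertex not lying on any edge of $M$ is unsaturated; an unsaturated vertex is at risk (with respect to $M$) if its $\Delta$ neighbours lie on $\Delta$ distinct edges of $M$. "$M$ leaves $r$ at-risk vertices" means there are exactly $r$ vertices at risk with respect to $M$. -}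

module Defs where

open import Data.Nat using (ℕ; zero; suc; _+_; _≤_; _<_; _<?_)
open import Data.Nat.Properties using (≮⇒≥; +-suc)
open import Data.Nat.Induction using (Acc; acc; <-wellFounded)
open import Data.Fin using (Fin; _≟_) renaming (_<_ to _<ᶠ_; _<?_ to _<ᶠ?_)
open import Data.Fin.Properties using (all?; any?)
open import Data.Fin.Subset using (Subset; ∣_∣; _∈_; _∉_; _∪_; ⁅_⁆; ⊤; ⊥; _⊃_)
open import Data.Fin.Subset.Properties
  using (_∈?_; ∈⊤; ∉⊥; anySubset?; p⊆p∪q; q⊆p∪q; x∈⁅x⁆)
open import Data.Fin.Subset.Induction using (⊃-wellFounded)
import Data.Integer as ℤ
open import Data.List using (List; length; lookup; filter; cartesianProduct; allFin)
open import Data.Product using (_×_; _,_; proj₁; proj₂; ∃)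
open import Data.Sum using (_⊎_)
open import Data.Vec using (tabulate)
open import Function using (_∘_)
open import Relation.Binary using (Rel; Symmetric; Irreflexive) renaming (Decidable to Decidable₂)
open import Relation.Binary.PropositionalEquality using (_≡_; _≢_; refl)
open import Relation.Nullary using (¬_; yes; no; does; contradiction)
open import Relation.Nullary.Decidable using (¬?; _×-dec_; _⊎-dec_; _→-dec_)
open import Relation.Unary using (Pred; Decidable)
open import Level using (0ℓ)

subset : ∀ {n} {P : Pred (Fin n) 0ℓ} → Decidable P → Subset n
subset P? = tabulate (does ∘ P?)

IsMinimumSize : ∀ {m} → Pred (Subset m) 0ℓ → ℕ → Set
IsMinimumSize P k = (∃ λ S → P S × ∣ S ∣ ≡ k) × (∀ S → P S → k ≤ ∣ S ∣)

minimumSize : ∀ {m} {P : Pred (Subset m) 0ℓ} → Decidable P → ∃ P → ∃ (IsMinimumSize P)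
minimumSize {P = P} P? (S₀ , p₀) = go S₀ p₀ (<-wellFounded ∣ S₀ ∣)
  where
  go : ∀ S → P S → Acc _<_ ∣ S ∣ → ∃ (IsMinimumSize P)
  go S p (acc rs) with anySubset? (λ T → P? T ×-dec (∣ T ∣ <? ∣ S ∣))
  ... | yes (T , q , T<S) = go T q (rs T<S)
  ... | no  none          =
    ∣ S ∣ , (S , p , refl) , λ T q → ≮⇒≥ (λ T<S → none (T , q , T<S))

record Graph (n : ℕ) : Set₁ where
  field
    Adj    : Rel (Fin n) 0ℓ
    adj?   : Decidable₂ Adj
    sym    : Symmetric Adj
    irrefl : Irreflexive _≡_ Adj

module _ {n : ℕ} (G : Graph n) where
  open Graph G

  neighbours : Fin n → Subset n
  neighbours v = subset (adj? v)

  Regular : ℕ → Set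
  Regular Δ = ∀ v → ∣ neighbours v ∣ ≡ Δ

  Dominating : Pred (Subset n) 0ℓ
  Dominating S = ∀ v → v ∉ S → ∃ λ w → Adj v w × w ∈ S

  dominating? : Decidable Dominating
  dominating? S = all? λ v →
    ¬? (v ∈? S) →-dec any? (λ w → adj? v w ×-dec (w ∈? S))

  dominationNumber : ∃ (IsMinimumSize Dominating)
  dominationNumber = minimumSize dominating? (⊤ , λ v v∉⊤ → contradiction ∈⊤ v∉⊤)

  γ : ℕ
  γ = proj₁ dominationNumber

  -- Every edge is listed exactly once, as the pair (u , v) with u < v.
  edges : List (Fin n × Fin n)
  edges = filter (λ (u , v) → (u <ᶠ? v) ×-dec adj? u v)
                 (cartesianProduct (allFin n) (allFin n))

  -- Edges are named by their positions in the list, so a set of edges is a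
  -- Subset (length edges), and distinct names are distinct edges.
  Edge : Set
  Edge = Fin (length edges)

  EdgeSet : Set
  EdgeSet = Subset (length edges)

  _LiesOn_ : Fin n → Edge → Set
  v LiesOn e = v ≡ proj₁ (lookup edges e) ⊎ v ≡ proj₂ (lookup edges e)

  _liesOn?_ : Decidable₂ _LiesOn_
  v liesOn? e = (v ≟ proj₁ (lookup edges e)) ⊎-dec (v ≟ proj₂ (lookup edges e))

  ShareVertex : Edge → Edge → Set
  ShareVertex e f = ∃ λ v → v LiesOn e × v LiesOn f

  Matching : Pred EdgeSet 0ℓ
  Matching M = ∀ e f → e ∈ M → f ∈ M → e ≢ f → ¬ ShareVertex e f

  MaximalMatching : Pred EdgeSet 0ℓ
  MaximalMatching M = Matching M × (∀ e → e ∉ M → ¬ Matching (M ∪ ⁅ e ⁆))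

  matching? : Decidable Matching
  matching? M = all? λ e → all? λ f →
    (e ∈? M) →-dec ((f ∈? M) →-dec (¬? (e ≟ f) →-dec
      ¬? (any? λ v → (v liesOn? e) ×-dec (v liesOn? f))))

  maximalMatching? : Decidable MaximalMatching
  maximalMatching? M =
    matching? M ×-dec (all? λ e → ¬? (e ∈? M) →-dec ¬? (matching? (M ∪ ⁅ e ⁆)))

  maximalMatching-exists : ∃ MaximalMatching
  maximalMatching-exists = go ⊥ (λ _ _ e∈⊥ → contradiction e∈⊥ ∉⊥) (⊃-wellFounded ⊥)
    where
    go : ∀ M → Matching M → Acc _⊃_ M → ∃ MaximalMatching
    go M m (acc rs) with any? (λ e → ¬? (e ∈? M) ×-dec matching? (M ∪ ⁅ e ⁆))
    ... | yes (e , e∉M , m′) =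
      go (M ∪ ⁅ e ⁆) m′ (rs (p⊆p∪q ⁅ e ⁆ , e , q⊆p∪q M ⁅ e ⁆ (x∈⁅x⁆ e) , e∉M))
    ... | no none = M , m , λ e e∉M m′ → none (e , e∉M , m′)

  edgeDominationNumber : ∃ (IsMinimumSize MaximalMatching)
  edgeDominationNumber = minimumSize maximalMatching? maximalMatching-exists

  γₑ : ℕ
  γₑ = proj₁ edgeDominationNumber

  MinimumMaximalMatching : Pred EdgeSet 0ℓ
  MinimumMaximalMatching M = MaximalMatching M × ∣ M ∣ ≡ γₑ

  module _ (M : EdgeSet) where

    Saturated : Pred (Fin n) 0ℓ
    Saturated v = ∃ λ e → e ∈ M × v LiesOn e

    -- The last two conjuncts say that the Δ neighbours of v lie on Δ distinct
    -- edges of M; a matching has at most one edge at each neighbour.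
    AtRisk : Pred (Fin n) 0ℓ
    AtRisk v =
        ¬ Saturated v
      × (∀ w → Adj v w → Saturated w)
      × (∀ w w′ → Adj v w → Adj v w′ → w ≢ w′ →
           ∀ e e′ → e ∈ M → e′ ∈ M → w LiesOn e → w′ LiesOn e′ → e ≢ e′)

    saturated? : Decidable Saturated
    saturated? v = any? λ e → (e ∈? M) ×-dec (v liesOn? e)

    atRisk? : Decidable AtRisk
    atRisk? v =
      ¬? (saturated? v)
      ×-dec (all? λ w → adj? v w →-dec saturated? w)
      ×-dec (all? λ w → all? λ w′ →
        adj? v w →-dec (adj? v w′ →-dec (¬? (w ≟ w′) →-dec
          (all? λ e → all? λ e′ →
            (e ∈? M) →-dec ((e′ ∈? M) →-dec ((w liesOn? e) →-dec
              ((w′ liesOn? e′) →-dec ¬? (e ≟ e′))))))))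

    atRiskCount : ℕ
    atRiskCount = ∣ subset atRisk? ∣

-- The quotient (Δ - 1) n / (2Δ - 1) is formed in ℤ, where the divisor is never
-- zero: for Δ = 0 it is -1, whereas truncated subtraction would give 0.
-- Data.Integer's _/_ is the floor for positive divisors, and is exact for -1.
2Δ-1-nonZero : ∀ Δ → ℤ.NonZero (ℤ.+ 2 ℤ.* ℤ.+ Δ ℤ.- ℤ.1ℤ)
2Δ-1-nonZero zero    = _
2Δ-1-nonZero (suc Δ) rewrite +-suc Δ (Δ + 0) = _

{-# OPTIONS --safe #-}
-- If S contains one endpoint of every edge of a maximal matching M, then only
-- at-risk vertices can fail to be dominated by S.  An at-risk vertex meets Δ
-- edges of M, each at one end, so it is missed by a fraction of at most 2^-Δ
-- of all choices of endpoints; with fewer than 2^Δ at-risk vertices some choice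
-- misses none.  The bound on the number of at-risk vertices counts the pairs of
-- an at-risk vertex and a neighbour of it: every saturated vertex has at most
-- Δ - 1 at-risk neighbours, because its mate is saturated.
module Submission where

open import Defs
open import Data.Bool using (Bool; true; false; if_then_else_)
open import Data.Empty using (⊥)
open import Data.Fin using (Fin; zero; suc; _≟_) renaming (_<_ to _<ᶠ_; _<?_ to _<ᶠ?_)
open import Data.Fin.Properties using (all?; any?) renaming (<-cmp to <ᶠ-cmp)
open import Data.Fin.Subset using (Subset; ∣_∣; _∈_; _∪_; ⁅_⁆; inside; outside)
open import Data.Fin.Subset.Properties using (_∈?_; x∈p∪q⁻; x∈⁅y⁆⇒x≡y)
import Data.Integer.Properties as ℤ
open import Data.List using (length; lookup; cartesianProduct; allFin)
import Data.List.Membership.Propositional as List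
open import Data.List.Membership.Propositional.Properties
  using (∈-lookup; ∈-filter⁺; ∈-filter⁻; ∈-cartesianProduct⁺; ∈-allFin)
import Data.List.Relation.Unary.Any as Any
import Data.List.Relation.Unary.Any.Properties as Any
open import Data.Nat using (ℕ; zero; suc; _≤_; _<_; z≤n; _∸_; _^_; _+_; _<?_; NonZero)
  renaming (_*_ to _·_)
open import Data.Nat.DivMod using (/-monoˡ-≤; m*n/n≡m) renaming (_/_ to _/ⁿ_)
open import Data.Nat.Properties hiding (_≟_)
open import Data.Nat.Tactic.RingSolver using (solve-∀)
open import Data.Product using (_×_; _,_; proj₁; proj₂; ∃)
open import Data.Sum using (_⊎_; inj₁; inj₂; [_,_]′)
open import Data.Unit using (tt)
open import Data.Vec using ([]; _∷_)
import Data.Vec.Functional as F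
open import Data.Vec.Properties using (lookup⇒[]=; lookup∘tabulate)
open import Function using (_∘_; const; case_of_)
open import Level using (0ℓ)
open import Relation.Binary using (tri<; tri≈; tri>)
open import Relation.Binary.PropositionalEquality
open import Relation.Nullary using (¬_; Dec; yes; no; does; contradiction)
open import Relation.Nullary.Decidable
  using (¬?; _×-dec_; _⊎-dec_; dec-true; decidable-stable; from-yes)
open import Relation.Unary using (Pred; Decidable)

open import Algebra.Properties.CommutativeMonoid.Sum +-0-commutativeMonoid
  using (sum; sum-syntax; sum-cong-≗; ∑-distrib-+; ∑-comm)
open import Algebra.Properties.Semiring.Sum +-*-semiring using (*-distribˡ-sum; *-distribʳ-sum)

-- Indicators of decidable propositions and counting by sums.

⟦_⟧ : ∀ {P : Set} → Dec P → ℕ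
⟦ P? ⟧ = if does P? then 1 else 0

⟦⟧-mono : ∀ {P Q : Set} (P? : Dec P) (Q? : Dec Q) → (P → Q) → ⟦ P? ⟧ ≤ ⟦ Q? ⟧
⟦⟧-mono (no _)  _       _   = z≤n
⟦⟧-mono (yes _) (yes _) _   = ≤-refl
⟦⟧-mono (yes p) (no ¬q) P⇒Q = contradiction (P⇒Q p) ¬q

⟦⟧-disjoint : ∀ {P Q R : Set} (P? : Dec P) (Q? : Dec Q) (R? : Dec R) →
              (P → R) → (Q → R) → (P → ¬ Q) → ⟦ P? ⟧ + ⟦ Q? ⟧ ≤ ⟦ R? ⟧
⟦⟧-disjoint (no _)  Q?      R? _   Q⇒R _    = ⟦⟧-mono Q? R? Q⇒R
⟦⟧-disjoint (yes p) (no _)  R? P⇒R _   _    = ⟦⟧-mono (yes p) R? P⇒R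
⟦⟧-disjoint (yes p) (yes q) _  _   _   P⇒¬Q = contradiction q (P⇒¬Q p)

⟦⟧≡0⇒¬ : ∀ {P : Set} (P? : Dec P) → ⟦ P? ⟧ ≡ 0 → ¬ P
⟦⟧≡0⇒¬ (no ¬p) _ = ¬p

⟦×⟧ : ∀ {P Q : Set} (P? : Dec P) (Q? : Dec Q) → ⟦ P? ×-dec Q? ⟧ ≡ ⟦ P? ⟧ · ⟦ Q? ⟧
⟦×⟧ (no _)  _  = refl
⟦×⟧ (yes _) Q? = sym (+-identityʳ ⟦ Q? ⟧)

sum-mono : ∀ {n} {f g : Fin n → ℕ} → (∀ i → f i ≤ g i) → sum f ≤ sum g
sum-mono {zero}  f≤g = z≤n
sum-mono {suc n} f≤g = +-mono-≤ (f≤g zero) (sum-mono (f≤g ∘ suc))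

term≤sum : ∀ {n} (f : Fin n → ℕ) i → f i ≤ sum f
term≤sum f zero    = m≤m+n (f zero) _
term≤sum f (suc i) = m≤n⇒m≤o+n (f zero) (term≤sum (f ∘ suc) i)

sum≡0⇒term≡0 : ∀ {n} {f : Fin n → ℕ} → sum f ≡ 0 → ∀ i → f i ≡ 0
sum≡0⇒term≡0 {f = f} eq i = n≤0⇒n≡0 (subst (f i ≤_) eq (term≤sum f i))

sum-const : ∀ n k → sum {n} (const k) ≡ n · k
sum-const zero    k = refl
sum-const (suc n) k = cong (k +_) (sum-const n k)

⟦⟧≤sum : ∀ {n} {Q : Set} {P : Pred (Fin n) 0ℓ} (Q? : Dec Q) (P? : Decidable P) →
         (Q → ∃ P) → ⟦ Q? ⟧ ≤ ∑[ i < n ] ⟦ P? i ⟧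
⟦⟧≤sum (no _)  P? _    = z≤n
⟦⟧≤sum (yes q) P? Q⇒∃P =
  let i , p = Q⇒∃P q in
  ≤-trans (⟦⟧-mono (yes q) (P? i) (const p)) (term≤sum (λ i → ⟦ P? i ⟧) i)

sum≤⟦⟧ : ∀ {n} {Q : Set} {P : Pred (Fin n) 0ℓ} (P? : Decidable P) (Q? : Dec Q) →
         (∀ i → P i → Q) → (∀ i j → P i → P j → i ≡ j) → ∑[ i < n ] ⟦ P? i ⟧ ≤ ⟦ Q? ⟧
sum≤⟦⟧ {zero}  P? Q? P⇒Q unique = z≤n
sum≤⟦⟧ {suc n} P? Q? P⇒Q unique with P? zero
... | no _  = sum≤⟦⟧ (P? ∘ suc) Q? (P⇒Q ∘ suc) λ i j p q → case unique _ _ p q of λ { refl → refl }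
... | yes p = begin
  -- By uniqueness `P` fails at every later index, so the induction applies with the false
  -- proposition in place of `Q`, and its indicator is 0.
  1 + ∑[ i < n ] ⟦ P? (suc i) ⟧ ≤⟨ +-monoʳ-≤ 1 (sum≤⟦⟧ {Q = ⊥} (P? ∘ suc) (no λ ())
                                                   (λ i q → case unique zero (suc i) p q of λ ())
                                                   (λ i j q _ → case unique zero (suc i) p q of λ ())) ⟩
  1                             ≤⟨ ⟦⟧-mono (yes p) Q? (P⇒Q zero) ⟩
  ⟦ Q? ⟧                        ∎
  where open ≤-Reasoning

∣subset∣ : ∀ {n} {P : Pred (Fin n) 0ℓ} (P? : Decidable P) → ∣ subset P? ∣ ≡ ∑[ i < n ] ⟦ P? i ⟧
∣subset∣ {zero}  P? = refl
∣subset∣ {suc n} P? with P? zero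
... | yes _ = cong suc (∣subset∣ (P? ∘ suc))
... | no _  = ∣subset∣ (P? ∘ suc)

∣∣≡sum : ∀ {n} (S : Subset n) → ∣ S ∣ ≡ ∑[ i < n ] ⟦ i ∈? S ⟧
∣∣≡sum []            = refl
∣∣≡sum (inside ∷ S)  = cong suc (∣∣≡sum S)
∣∣≡sum (outside ∷ S) = ∣∣≡sum S

∈-subset⁺ : ∀ {n} {P : Pred (Fin n) 0ℓ} (P? : Decidable P) {i} → P i → i ∈ subset P?
∈-subset⁺ P? {i} p = lookup⇒[]= i _ (trans (lookup∘tabulate (does ∘ P?) i) (dec-true (P? i) p))

-- Sums over all `2 ^ L` Boolean choice functions.

total : ∀ L → ((Fin L → Bool) → ℕ) → ℕ
total zero    f = f F.[]
total (suc L) f = total L (f ∘ (true F.∷_)) + total L (f ∘ (false F.∷_))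

total-mono : ∀ L {f g : (Fin L → Bool) → ℕ} → (∀ c → f c ≤ g c) → total L f ≤ total L g
total-mono zero    f≤g = f≤g F.[]
total-mono (suc L) f≤g = +-mono-≤ (total-mono L (f≤g ∘ (true F.∷_))) (total-mono L (f≤g ∘ (false F.∷_)))

total-*ˡ : ∀ L k f → total L (λ c → k · f c) ≡ k · total L f
total-*ˡ zero    k f = refl
total-*ˡ (suc L) k f = trans (cong₂ _+_ (total-*ˡ L k _) (total-*ˡ L k _)) (sym (*-distribˡ-+ k _ _))

total-sum : ∀ L {n} (f : Fin n → (Fin L → Bool) → ℕ) →
            total L (λ c → ∑[ i < n ] f i c) ≡ ∑[ i < n ] total L (f i)
total-sum zero    f = refl
total-sum (suc L) f = trans
  (cong₂ _+_ (total-sum L (λ i → f i ∘ (true F.∷_))) (total-sum L (λ i → f i ∘ (false F.∷_))))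
  (sym (∑-distrib-+ (λ i → total L (f i ∘ (true F.∷_))) (λ i → total L (f i ∘ (false F.∷_)))))

-- Pigeonhole: `2 ^ L` positive terms would sum to at least `2 ^ L`. The search fixes one value at a
-- time, always keeping a half whose sum is below the number of its terms.
total<2^⇒zero : ∀ L f → total L f < 2 ^ L → ∃ λ c → f c ≡ 0
total<2^⇒zero zero    f f<1 = F.[] , n<1⇒n≡0 f<1
total<2^⇒zero (suc L) f t<2^ with total L (f ∘ (true F.∷_)) <? 2 ^ L
... | yes lt = let c , eq = total<2^⇒zero L _ lt in true F.∷ c , eq
... | no ≮   = let c , eq = total<2^⇒zero L (f ∘ (false F.∷_)) lt in false F.∷ c , eq
  where
  lt : total L (f ∘ (false F.∷_)) < 2 ^ L
  lt = +-cancelˡ-< (2 ^ L) _ _ (begin-strict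
    2 ^ L + total L (f ∘ (false F.∷_))   ≤⟨ +-monoˡ-≤ _ (≮⇒≥ ≮) ⟩
    total (suc L) f                      <⟨ t<2^ ⟩
    2 · 2 ^ L                            ≡⟨ cong (2 ^ L +_) (+-identityʳ (2 ^ L)) ⟩
    2 ^ L + 2 ^ L                        ∎)
    where open ≤-Reasoning

-- Choices that avoid a family of hits.

module _ {L} {H : Fin L → Bool → Set} (H? : ∀ e b → Dec (H e b)) where

  Avoids : (Fin L → Bool) → Set
  Avoids c = ∀ e → ¬ H e (c e)

  avoids? : Decidable Avoids
  avoids? c = all? λ e → ¬? (H? e (c e))

  hittable? : ∀ e → Dec (H e true ⊎ H e false)
  hittable? e = H? e true ⊎-dec H? e false

⟦all?⟧ : ∀ {n} {P : Pred (Fin (suc n)) 0ℓ} (P? : Decidable P) →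
         ⟦ all? P? ⟧ ≡ ⟦ P? zero ⟧ · ⟦ all? (P? ∘ suc) ⟧
⟦all?⟧ P? with P? zero
... | yes _ = sym (+-identityʳ _)
... | no _  = refl

-- The positions are independent. A hittable position leaves at most one of its two values, any
-- other leaves both, so each position contributes a factor of at most 2 to the left side.
-- Multiplying by the power of two replaces a division.
2^hittable*total-avoids : ∀ {L} {H : Fin L → Bool → Set} (H? : ∀ e b → Dec (H e b)) →
  2 ^ (∑[ e < L ] ⟦ hittable? H? e ⟧) · total L (λ c → ⟦ avoids? H? c ⟧) ≤ 2 ^ L
2^hittable*total-avoids {zero}  H? = ≤-refl
2^hittable*total-avoids {suc L} {H} H? = begin
  2 ^ (h + k) · (total L _ + total L _)            ≡⟨ cong₂ (λ x y → 2 ^ (h + k) · (x + y)) (split true) (split false) ⟩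
  2 ^ (h + k) · (miss true · t + miss false · t)   ≡⟨ cong (_· (miss true · t + miss false · t)) (^-distribˡ-+-* 2 h k) ⟩
  2 ^ h · 2 ^ k · (miss true · t + miss false · t) ≡⟨ rearrange (2 ^ h) (2 ^ k) (miss true) (miss false) t ⟩
  2 ^ h · (miss true + miss false) · (2 ^ k · t)   ≤⟨ *-mono-≤ (misses (H? zero true) (H? zero false)) (2^hittable*total-avoids (H? ∘ suc)) ⟩
  2 · 2 ^ L                                        ∎
  where
  open ≤-Reasoning
  h k t : ℕ
  h = ⟦ hittable? H? zero ⟧
  k = ∑[ e < L ] ⟦ hittable? H? (suc e) ⟧
  t = total L (λ c → ⟦ avoids? (H? ∘ suc) c ⟧)
  miss : Bool → ℕ
  miss b = ⟦ ¬? (H? zero b) ⟧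
  split : ∀ b → total L (λ c → ⟦ avoids? H? (b F.∷ c) ⟧) ≡ miss b · t
  split b = trans
    -- The summands agree only pointwise, so monotonicity of `total` is used in both directions.
    (≤-antisym (total-mono L λ c → ≤-reflexive (⟦all?⟧ (λ e → ¬? (H? e ((b F.∷ c) e)))))
               (total-mono L λ c → ≤-reflexive (sym (⟦all?⟧ (λ e → ¬? (H? e ((b F.∷ c) e)))))))
    (total-*ˡ L (miss b) _)
  rearrange : ∀ p q x y t → p · q · (x · t + y · t) ≡ p · (x + y) · (q · t)
  rearrange = solve-∀
  misses : ∀ {A B : Set} (A? : Dec A) (B? : Dec B) →
           2 ^ ⟦ A? ⊎-dec B? ⟧ · (⟦ ¬? A? ⟧ + ⟦ ¬? B? ⟧) ≤ 2
  misses (yes _) (yes _) = z≤n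
  misses (yes _) (no _)  = ≤-refl
  misses (no _)  (yes _) = ≤-refl
  misses (no _)  (no _)  = ≤-refl

-- Edges, their ends, and maximal matchings.

module _ {n : ℕ} (G : Graph n) where
  open Graph G renaming (sym to adj-sym)

  -- With ends named by Booleans, a choice of one endpoint for every edge is a function
  -- `Edge G → Bool`.
  end : Edge G → Bool → Fin n
  end e true  = proj₁ (lookup (edges G) e)
  end e false = proj₂ (lookup (edges G) e)

  ends-adj : ∀ e → Adj (end e true) (end e false)
  ends-adj e = proj₂ (proj₂ (∈-filter⁻ (λ (u , v) → (u <ᶠ? v) ×-dec adj? u v)
    {xs = cartesianProduct (allFin n) (allFin n)} (∈-lookup e)))

  liesOn⇒≡end⊎adj-end : ∀ {v e} b → _LiesOn_ G v e → v ≡ end e b ⊎ Adj v (end e b)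
  liesOn⇒≡end⊎adj-end         true  (inj₁ v≡)   = inj₁ v≡
  liesOn⇒≡end⊎adj-end {e = e} true  (inj₂ refl) = inj₂ (adj-sym (ends-adj e))
  liesOn⇒≡end⊎adj-end {e = e} false (inj₁ refl) = inj₂ (ends-adj e)
  liesOn⇒≡end⊎adj-end         false (inj₂ v≡)   = inj₁ v≡

  mate : ∀ {v e} → _LiesOn_ G v e → ∃ λ w → Adj v w × _LiesOn_ G w e
  mate {e = e} (inj₁ refl) = end e false , ends-adj e , inj₂ refl
  mate {e = e} (inj₂ refl) = end e true , adj-sym (ends-adj e) , inj₁ refl

  two-liesOn⇒end : ∀ {v w e} b → v ≢ w → _LiesOn_ G v e → _LiesOn_ G w e → v ≡ end e b ⊎ w ≡ end e b
  two-liesOn⇒end true  _   (inj₁ p) _        = inj₁ p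
  two-liesOn⇒end true  _   (inj₂ _) (inj₁ q) = inj₂ q
  two-liesOn⇒end false _   (inj₂ p) _        = inj₁ p
  two-liesOn⇒end false _   (inj₁ _) (inj₂ q) = inj₂ q
  two-liesOn⇒end true  v≢w (inj₂ p) (inj₂ q) = contradiction (trans p (sym q)) v≢w
  two-liesOn⇒end false v≢w (inj₁ p) (inj₁ q) = contradiction (trans p (sym q)) v≢w

  <⇒edge : ∀ {v w} → v <ᶠ w → Adj v w → ∃ λ e → lookup (edges G) e ≡ (v , w)
  <⇒edge {v} {w} v<w v~w = Any.index vw∈ , sym (Any.lookup-index vw∈)
    where
    vw∈ : (v , w) List.∈ edges G
    vw∈ = ∈-filter⁺ (λ (u , v) → (u <ᶠ? v) ×-dec adj? u v)
            (∈-cartesianProduct⁺ (∈-allFin v) (∈-allFin w)) (v<w , v~w)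

  -- Only the pair with the smaller vertex first is listed in `edges`, so the order of `v` and `w`
  -- decides which pair to look up.
  adj⇒edge : ∀ {v w} → Adj v w →
             ∃ λ e → _LiesOn_ G v e × (∀ x → _LiesOn_ G x e → x ≡ v ⊎ x ≡ w)
  adj⇒edge {v} {w} v~w with <ᶠ-cmp v w
  ... | tri≈ _ v≡w _ = contradiction v~w (irrefl v≡w)
  ... | tri< v<w _ _ =
    let e , eq = <⇒edge v<w v~w in
    e , inj₁ (sym (cong proj₁ eq)) , λ x →
      [ (λ p → inj₁ (trans p (cong proj₁ eq))) , (λ p → inj₂ (trans p (cong proj₂ eq))) ]′
  ... | tri> _ _ w<v =
    let e , eq = <⇒edge w<v (adj-sym v~w) in
    e , inj₂ (sym (cong proj₂ eq)) , λ x →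
      [ (λ p → inj₂ (trans p (cong proj₁ eq))) , (λ p → inj₁ (trans p (cong proj₂ eq))) ]′

  ∣E∣ : ℕ
  ∣E∣ = length (edges G)

  saturated-neighbour : ∀ {M v} → Saturated G M v → ∃ λ w → Adj v w × Saturated G M w
  saturated-neighbour (e , e∈M , v-on-e) =
    let w , v~w , w-on-e = mate v-on-e in w , v~w , e , e∈M , w-on-e

  -- If `w` were unsaturated as well, the edge joining `v` and `w` would meet no edge of `M` and
  -- could be added to it, against maximality.
  unsaturated-independent : ∀ {M} → MaximalMatching G M → ∀ {v} → ¬ Saturated G M v →
                            ∀ w → Adj v w → Saturated G M w
  unsaturated-independent {M} (M-matching , M-maximal) {v} v-unsat w v~w =
    decidable-stable (saturated? G M w) λ w-unsat →
      let
        e , v-on-e , on-e = adj⇒edge v~w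
        unsat : ∀ x → _LiesOn_ G x e → ¬ Saturated G M x
        unsat x x-on-e sat = [ (λ { refl → v-unsat sat }) , (λ { refl → w-unsat sat }) ]′ (on-e x x-on-e)
        ∪-matching : Matching G (M ∪ ⁅ e ⁆)
        ∪-matching = λ f g f∈ g∈ f≢g (x , x-on-f , x-on-g) →
          case x∈p∪q⁻ M ⁅ e ⁆ f∈ , x∈p∪q⁻ M ⁅ e ⁆ g∈ of λ where
            (inj₁ f∈M , inj₁ g∈M) → M-matching f g f∈M g∈M f≢g (x , x-on-f , x-on-g)
            (inj₁ f∈M , inj₂ g∈e) → case x∈⁅y⁆⇒x≡y e g∈e of λ { refl → unsat x x-on-g (f , f∈M , x-on-f) }
            (inj₂ f∈e , inj₁ g∈M) → case x∈⁅y⁆⇒x≡y e f∈e of λ { refl → unsat x x-on-f (g , g∈M , x-on-g) }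
            (inj₂ f∈e , inj₂ g∈e) → f≢g (trans (x∈⁅y⁆⇒x≡y e f∈e) (sym (x∈⁅y⁆⇒x≡y e g∈e)))
      in M-maximal e (λ e∈M → v-unsat (e , e∈M , v-on-e)) ∪-matching

  degree : ∀ {Δ} → Regular G Δ → ∀ v → ∑[ w < n ] ⟦ adj? v w ⟧ ≡ Δ
  degree regular v = trans (sym (∣subset∣ (adj? v))) (regular v)

  -- At-risk vertices and the sets of chosen ends.

  module _ (M : EdgeSet G) where

    saturatedCount : ℕ
    saturatedCount = ∑[ w < n ] ⟦ saturated? G M w ⟧

    atRisk-saturated-disjoint : ∀ v → ⟦ atRisk? G M v ⟧ + ⟦ saturated? G M v ⟧ ≤ 1
    atRisk-saturated-disjoint v =
      ⟦⟧-disjoint (atRisk? G M v) (saturated? G M v) (yes tt) _ _ proj₁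

    atRisk+saturated≤n : atRiskCount G M + saturatedCount ≤ n
    atRisk+saturated≤n = begin
      atRiskCount G M + saturatedCount                            ≡⟨ cong (_+ saturatedCount) (∣subset∣ (atRisk? G M)) ⟩
      ∑[ v < n ] ⟦ atRisk? G M v ⟧ + saturatedCount               ≡⟨ ∑-distrib-+ (λ v → ⟦ atRisk? G M v ⟧) (λ v → ⟦ saturated? G M v ⟧) ⟨
      ∑[ v < n ] (⟦ atRisk? G M v ⟧ + ⟦ saturated? G M v ⟧)       ≤⟨ sum-mono atRisk-saturated-disjoint ⟩
      sum {n} (const 1)                                           ≡⟨ sum-const n 1 ⟩
      n · 1                                                       ≡⟨ *-identityʳ n ⟩
      n                                                           ∎
      where open ≤-Reasoning

    atRisk-neighbour? : ∀ w v → Dec (AtRisk G M v × Adj v w)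
    atRisk-neighbour? w v = atRisk? G M v ×-dec adj? v w

    -- Choices are made on all edges of `G`; the conjunct `e ∈ M` gives weight only to those made on
    -- `M`.
    EndAdj : Fin n → Edge G → Bool → Set
    EndAdj v e b = e ∈ M × Adj v (end e b)

    endAdj? : ∀ v e b → Dec (EndAdj v e b)
    endAdj? v e b = (e ∈? M) ×-dec adj? v (end e b)

    Missed : (Edge G → Bool) → Fin n → Set
    Missed c v = AtRisk G M v × Avoids (endAdj? v) c

    missed? : ∀ c → Decidable (Missed c)
    missed? c v = atRisk? G M v ×-dec avoids? (endAdj? v) c

    ChosenEnd : (Edge G → Bool) → Pred (Fin n) 0ℓ
    ChosenEnd c v = ∃ λ e → e ∈ M × v ≡ end e (c e)

    chosenEnd? : ∀ c → Decidable (ChosenEnd c)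
    chosenEnd? c v = any? λ e → (e ∈? M) ×-dec (v ≟ end e (c e))

    -- Counts pairs of a chosen vertex and an edge of `M` that chose it: at least one for each
    -- vertex, at most one for each edge.
    ∣chosenEnds∣≤∣M∣ : ∀ c → ∣ subset (chosenEnd? c) ∣ ≤ ∣ M ∣
    ∣chosenEnds∣≤∣M∣ c = begin
      ∣ subset (chosenEnd? c) ∣                   ≡⟨ ∣subset∣ (chosenEnd? c) ⟩
      ∑[ v < n ] ⟦ chosenEnd? c v ⟧               ≤⟨ sum-mono (λ v → ⟦⟧≤sum (chosenEnd? c v) (chosen? v) λ p → p) ⟩
      ∑[ v < n ] ∑[ e < ∣E∣ ] ⟦ chosen? v e ⟧     ≡⟨ ∑-comm (λ v e → ⟦ chosen? v e ⟧) ⟩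
      ∑[ e < ∣E∣ ] ∑[ v < n ] ⟦ chosen? v e ⟧     ≤⟨ sum-mono (λ e → sum≤⟦⟧ (λ v → chosen? v e) (e ∈? M) (λ _ → proj₁)
                                                       λ v w (_ , v≡) (_ , w≡) → trans v≡ (sym w≡)) ⟩
      ∑[ e < ∣E∣ ] ⟦ e ∈? M ⟧                     ≡⟨ ∣∣≡sum M ⟨
      ∣ M ∣                                       ∎
      where
      open ≤-Reasoning
      chosen? : ∀ v e → Dec (e ∈ M × v ≡ end e (c e))
      chosen? v e = (e ∈? M) ×-dec (v ≟ end e (c e))

    -- An undominated vertex would be missed. It is unsaturated, because a vertex on an edge of `M`
    -- is the chosen end or adjacent to it; its neighbours are saturated by maximality; and two
    -- neighbours on one edge of `M` would include the chosen end.
    none-missed⇒dominating : MaximalMatching G M → ∀ c → (∀ v → ¬ Missed c v) →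
                             Dominating G (subset (chosenEnd? c))
    none-missed⇒dominating maximal c none-missed v v∉S
      with any? (λ w → adj? v w ×-dec (w ∈? subset (chosenEnd? c)))
    ... | yes dominated  = dominated
    ... | no undominated = contradiction (v-risk , avoids) (none-missed v)
      where
      S = subset (chosenEnd? c)
      end∈S : ∀ {e} → e ∈ M → end e (c e) ∈ S
      end∈S {e} e∈M = ∈-subset⁺ (chosenEnd? c) (e , e∈M , refl)
      avoids : Avoids (endAdj? v) c
      avoids e (e∈M , v~end) = undominated (end e (c e) , v~end , end∈S e∈M)
      v-unsat : ¬ Saturated G M v
      v-unsat (e , e∈M , v-on-e) with liesOn⇒≡end⊎adj-end (c e) v-on-e
      ... | inj₁ refl  = v∉S (end∈S e∈M)
      ... | inj₂ v~end = avoids e (e∈M , v~end)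
      v-risk : AtRisk G M v
      v-risk = v-unsat , unsaturated-independent maximal v-unsat , distinct
        where
        distinct : ∀ w w′ → Adj v w → Adj v w′ → w ≢ w′ → ∀ e e′ → e ∈ M → e′ ∈ M →
                   _LiesOn_ G w e → _LiesOn_ G w′ e′ → e ≢ e′
        distinct w w′ v~w v~w′ w≢w′ e .e e∈M _ w-on-e w′-on-e refl
          with two-liesOn⇒end (c e) w≢w′ w-on-e w′-on-e
        ... | inj₁ refl = avoids e (e∈M , v~w)
        ... | inj₂ refl = avoids e (e∈M , v~w′)

    -- Counting in a regular graph.

    module _ {Δ} (regular : Regular G Δ) where

      -- The indicator added on the left stands for the subtraction in `Δ - 1`. For unsaturated `w`
      -- the right side is 0, and so is the left, since at-risk vertices have only saturated
      -- neighbours.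
      atRisk-neighbours : ∀ w → ∑[ v < n ] ⟦ atRisk-neighbour? w v ⟧ + ⟦ saturated? G M w ⟧
                              ≤ Δ · ⟦ saturated? G M w ⟧
      atRisk-neighbours w with saturated? G M w
      ... | no w-unsat = begin
        ∑[ v < n ] ⟦ atRisk-neighbour? w v ⟧ + 0 ≡⟨ +-identityʳ _ ⟩
        ∑[ v < n ] ⟦ atRisk-neighbour? w v ⟧     ≤⟨ sum-mono (λ v → ⟦⟧-mono (atRisk-neighbour? w v) (no w-unsat) λ ((_ , sat , _) , v~w) → sat w v~w) ⟩
        sum {n} (const 0)                        ≡⟨ sum-const n 0 ⟩
        n · 0                                    ≡⟨ *-zeroʳ n ⟩
        0                                        ≡⟨ *-zeroʳ Δ ⟨
        Δ · 0                                    ∎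
        where open ≤-Reasoning
      ... | yes w-sat =
        let x , w~x , x-sat = saturated-neighbour w-sat in begin
        -- The 1 is charged to the mate `x` of `w`: a neighbour of `w` that is saturated, hence not
        -- at risk.
        ∑[ v < n ] ⟦ atRisk-neighbour? w v ⟧ + 1                        ≤⟨ +-monoʳ-≤ _ (⟦⟧≤sum (yes tt) (_≟ x) λ _ → x , refl) ⟩
        ∑[ v < n ] ⟦ atRisk-neighbour? w v ⟧ + ∑[ v < n ] ⟦ v ≟ x ⟧     ≡⟨ ∑-distrib-+ (λ v → ⟦ atRisk-neighbour? w v ⟧) (λ v → ⟦ v ≟ x ⟧) ⟨
        ∑[ v < n ] (⟦ atRisk-neighbour? w v ⟧ + ⟦ v ≟ x ⟧)              ≤⟨ sum-mono (λ v → ⟦⟧-disjoint (atRisk-neighbour? w v) (v ≟ x) (adj? w v)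
                                                                            (λ (_ , v~w) → adj-sym v~w) (λ { refl → w~x }) (λ { (v-risk , _) refl → proj₁ v-risk x-sat })) ⟩
        ∑[ v < n ] ⟦ adj? w v ⟧                                         ≡⟨ degree regular w ⟩
        Δ                                                               ≡⟨ *-identityʳ Δ ⟨
        Δ · 1                                                           ∎
        where open ≤-Reasoning

      -- The pairs of an at-risk vertex and a neighbour number exactly `Δ` per at-risk vertex;
      -- grouped by the neighbour instead, they are bounded by `atRisk-neighbours`.
      Δ*atRisk+saturated≤Δ*saturated : Δ · atRiskCount G M + saturatedCount ≤ Δ · saturatedCount
      Δ*atRisk+saturated≤Δ*saturated = begin
        Δ · atRiskCount G M + s                                              ≡⟨ cong (_+ s) double-count ⟩
        ∑[ w < n ] ∑[ v < n ] ⟦ atRisk-neighbour? w v ⟧ + s                  ≡⟨ ∑-distrib-+ (λ w → ∑[ v < n ] ⟦ atRisk-neighbour? w v ⟧) (λ w → ⟦ saturated? G M w ⟧) ⟨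
        ∑[ w < n ] (∑[ v < n ] ⟦ atRisk-neighbour? w v ⟧ + ⟦ saturated? G M w ⟧) ≤⟨ sum-mono atRisk-neighbours ⟩
        ∑[ w < n ] (Δ · ⟦ saturated? G M w ⟧)                                ≡⟨ *-distribˡ-sum Δ (λ w → ⟦ saturated? G M w ⟧) ⟨
        Δ · s                                                                ∎
        where
        open ≤-Reasoning
        s = saturatedCount
        from : ∀ v → Δ · ⟦ atRisk? G M v ⟧ ≡ ∑[ w < n ] ⟦ atRisk-neighbour? w v ⟧
        from v = begin-equality
          Δ · ⟦ atRisk? G M v ⟧                             ≡⟨ *-comm Δ _ ⟩
          ⟦ atRisk? G M v ⟧ · Δ                             ≡⟨ cong (⟦ atRisk? G M v ⟧ ·_) (degree regular v) ⟨
          ⟦ atRisk? G M v ⟧ · ∑[ w < n ] ⟦ adj? v w ⟧       ≡⟨ *-distribˡ-sum ⟦ atRisk? G M v ⟧ (λ w → ⟦ adj? v w ⟧) ⟩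
          ∑[ w < n ] (⟦ atRisk? G M v ⟧ · ⟦ adj? v w ⟧)     ≡⟨ sum-cong-≗ (λ w → ⟦×⟧ (atRisk? G M v) (adj? v w)) ⟨
          ∑[ w < n ] ⟦ atRisk-neighbour? w v ⟧              ∎
        double-count : Δ · atRiskCount G M ≡ ∑[ w < n ] ∑[ v < n ] ⟦ atRisk-neighbour? w v ⟧
        double-count = begin-equality
          Δ · atRiskCount G M                               ≡⟨ cong (Δ ·_) (∣subset∣ (atRisk? G M)) ⟩
          Δ · ∑[ v < n ] ⟦ atRisk? G M v ⟧                  ≡⟨ *-distribˡ-sum Δ (λ v → ⟦ atRisk? G M v ⟧) ⟩
          ∑[ v < n ] (Δ · ⟦ atRisk? G M v ⟧)                ≡⟨ sum-cong-≗ from ⟩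
          ∑[ v < n ] ∑[ w < n ] ⟦ atRisk-neighbour? w v ⟧   ≡⟨ ∑-comm (λ v w → ⟦ atRisk-neighbour? w v ⟧) ⟩
          ∑[ w < n ] ∑[ v < n ] ⟦ atRisk-neighbour? w v ⟧   ∎

      -- Each neighbour of `v` is an end of an edge of `M`, which is thereby hittable, and no edge
      -- of `M` is reached from two neighbours.
      Δ≤hittable : ∀ {v} → AtRisk G M v → Δ ≤ ∑[ e < ∣E∣ ] ⟦ hittable? (endAdj? v) e ⟧
      Δ≤hittable {v} (_ , nbr-sat , nbr-distinct) = begin
        Δ                                             ≡⟨ degree regular v ⟨
        ∑[ w < n ] ⟦ adj? v w ⟧                       ≤⟨ sum-mono (λ w → ⟦⟧≤sum (adj? v w) (λ e → joins? w e) λ v~w →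
                                                           let e , e∈M , w-on-e = nbr-sat w v~w in e , v~w , e∈M , w-on-e) ⟩
        ∑[ w < n ] ∑[ e < ∣E∣ ] ⟦ joins? w e ⟧        ≡⟨ ∑-comm (λ w e → ⟦ joins? w e ⟧) ⟩
        ∑[ e < ∣E∣ ] ∑[ w < n ] ⟦ joins? w e ⟧        ≤⟨ sum-mono (λ e → sum≤⟦⟧ (λ w → joins? w e) (hittable? (endAdj? v) e) hit unique) ⟩
        ∑[ e < ∣E∣ ] ⟦ hittable? (endAdj? v) e ⟧      ∎
        where
        open ≤-Reasoning
        joins? : ∀ w e → Dec (Adj v w × e ∈ M × _LiesOn_ G w e)
        joins? w e = adj? v w ×-dec ((e ∈? M) ×-dec _liesOn?_ G w e)
        hit : ∀ {e} w → Adj v w × e ∈ M × _LiesOn_ G w e → EndAdj v e true ⊎ EndAdj v e false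
        hit w (v~w , e∈M , inj₁ refl) = inj₁ (e∈M , v~w)
        hit w (v~w , e∈M , inj₂ refl) = inj₂ (e∈M , v~w)
        unique : ∀ {e} w w′ → Adj v w × e ∈ M × _LiesOn_ G w e → Adj v w′ × e ∈ M × _LiesOn_ G w′ e → w ≡ w′
        unique {e} w w′ (v~w , e∈M , w-on-e) (v~w′ , _ , w′-on-e) =
          decidable-stable (w ≟ w′) λ w≢w′ →
            nbr-distinct w w′ v~w v~w′ w≢w′ e e e∈M e∈M w-on-e w′-on-e refl

      -- The bound `2^-Δ` on the fraction of choices that miss `v`, with denominators cleared. The
      -- indicator on the right allows summation over all vertices.
      2^Δ*total-missed : ∀ v → 2 ^ Δ · total ∣E∣ (λ c → ⟦ missed? c v ⟧) ≤ ⟦ atRisk? G M v ⟧ · 2 ^ ∣E∣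
      2^Δ*total-missed v = begin
        2 ^ Δ · total ∣E∣ (λ c → ⟦ missed? c v ⟧)
          ≤⟨ *-monoʳ-≤ (2 ^ Δ) (total-mono ∣E∣ λ c → ≤-reflexive (⟦×⟧ (atRisk? G M v) (avoids? (endAdj? v) c))) ⟩
        2 ^ Δ · total ∣E∣ (λ c → ⟦ atRisk? G M v ⟧ · ⟦ avoids? (endAdj? v) c ⟧)
          ≡⟨ cong (2 ^ Δ ·_) (total-*ˡ ∣E∣ ⟦ atRisk? G M v ⟧ _) ⟩
        2 ^ Δ · (⟦ atRisk? G M v ⟧ · t)
          ≤⟨ bound (atRisk? G M v) ⟩
        ⟦ atRisk? G M v ⟧ · 2 ^ ∣E∣
          ∎
        where
        open ≤-Reasoning
        t : ℕ
        t = total ∣E∣ (λ c → ⟦ avoids? (endAdj? v) c ⟧)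
        bound : (risk? : Dec (AtRisk G M v)) → 2 ^ Δ · (⟦ risk? ⟧ · t) ≤ ⟦ risk? ⟧ · 2 ^ ∣E∣
        bound (no _)     = ≤-reflexive (*-zeroʳ (2 ^ Δ))
        bound (yes risk) = begin
          2 ^ Δ · (1 · t)                                       ≡⟨ cong (2 ^ Δ ·_) (*-identityˡ t) ⟩
          2 ^ Δ · t                                             ≤⟨ *-monoˡ-≤ t (^-monoʳ-≤ 2 (Δ≤hittable risk)) ⟩
          2 ^ (∑[ e < ∣E∣ ] ⟦ hittable? (endAdj? v) e ⟧) · t    ≤⟨ 2^hittable*total-avoids (endAdj? v) ⟩
          2 ^ ∣E∣                                               ≡⟨ *-identityˡ (2 ^ ∣E∣) ⟨
          1 · 2 ^ ∣E∣                                           ∎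

      -- First-moment argument: the number of missed vertices, summed over all choices, is less than
      -- the number `2 ^ ∣E∣` of choices, so some choice misses none.
      few-atRisk⇒none-missed : atRiskCount G M ≤ 2 ^ Δ ∸ 1 → ∃ λ c → ∀ v → ¬ Missed c v
      few-atRisk⇒none-missed few =
        let c , eq = total<2^⇒zero ∣E∣ missed (*-cancelˡ-< (2 ^ Δ) _ _ (begin-strict
              2 ^ Δ · total ∣E∣ missed                                         ≡⟨ cong (2 ^ Δ ·_) (total-sum ∣E∣ λ v c → ⟦ missed? c v ⟧) ⟩
              2 ^ Δ · ∑[ v < n ] total ∣E∣ (λ c → ⟦ missed? c v ⟧)             ≡⟨ *-distribˡ-sum (2 ^ Δ) (λ v → total ∣E∣ (λ c → ⟦ missed? c v ⟧)) ⟩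
              ∑[ v < n ] (2 ^ Δ · total ∣E∣ (λ c → ⟦ missed? c v ⟧))           ≤⟨ sum-mono 2^Δ*total-missed ⟩
              ∑[ v < n ] (⟦ atRisk? G M v ⟧ · 2 ^ ∣E∣)                           ≡⟨ *-distribʳ-sum (2 ^ ∣E∣) (λ v → ⟦ atRisk? G M v ⟧) ⟨
              ∑[ v < n ] ⟦ atRisk? G M v ⟧ · 2 ^ ∣E∣                             ≡⟨ cong (_· 2 ^ ∣E∣) (∣subset∣ (atRisk? G M)) ⟨
              atRiskCount G M · 2 ^ ∣E∣                                          <⟨ *-monoˡ-< (2 ^ ∣E∣) {{m^n≢0 2 ∣E∣}} (≤-<-trans few (m∸1<m (m^n>0 2 Δ))) ⟩
              2 ^ Δ · 2 ^ ∣E∣                                                    ∎))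
        in c , λ v → ⟦⟧≡0⇒¬ (missed? c v) (sum≡0⇒term≡0 eq v)
        where
        open ≤-Reasoning
        missed : (Edge G → Bool) → ℕ
        missed c = ∑[ v < n ] ⟦ missed? c v ⟧
        m∸1<m : ∀ {m} → 0 < m → m ∸ 1 < m
        m∸1<m {suc m} _ = ≤-refl

      few-atRisk⇒γ≤γₑ : MinimumMaximalMatching G M → atRiskCount G M ≤ 2 ^ Δ ∸ 1 → γ G ≤ γₑ G
      few-atRisk⇒γ≤γₑ (maximal , ∣M∣≡γₑ) few =
        let
          c , none-missed = few-atRisk⇒none-missed few
          dominating = none-missed⇒dominating maximal c none-missed
        in begin
          γ G                         ≤⟨ proj₂ (proj₂ (dominationNumber G)) _ dominating ⟩
          ∣ subset (chosenEnd? c) ∣   ≤⟨ ∣chosenEnds∣≤∣M∣ c ⟩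
          ∣ M ∣                       ≡⟨ ∣M∣≡γₑ ⟩
          γₑ G                        ∎
        where open ≤-Reasoning

-- Numerical bounds in terms of the number of vertices.

module _ {n} (G : Graph n) where

  -- d + suc (d + 0) is the normal form of 2Δ - 1 for Δ = suc d.
  [2Δ-1]*atRisk≤[Δ-1]*n : ∀ {d} → Regular G (suc d) → ∀ M →
                          (d + suc (d + 0)) · atRiskCount G M ≤ d · n
  [2Δ-1]*atRisk≤[Δ-1]*n {d} regular M = begin
    -- Since `2Δ - 1 = Δ + d`, the first `Δ` copies of `r` are traded for `d` copies of `s`, and
    -- `r + s ≤ n` finishes.
    (d + suc (d + 0)) · r   ≡⟨ expand d r ⟩
    suc d · r + d · r       ≤⟨ +-monoˡ-≤ (d · r) Δr≤ds ⟩
    d · s + d · r           ≡⟨ *-distribˡ-+ d s r ⟨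
    d · (s + r)             ≡⟨ cong (d ·_) (+-comm s r) ⟩
    d · (r + s)             ≤⟨ *-monoʳ-≤ d (atRisk+saturated≤n G M) ⟩
    d · n                   ∎
    where
    open ≤-Reasoning
    r s : ℕ
    r = atRiskCount G M
    s = saturatedCount G M
    expand : ∀ d r → (d + suc (d + 0)) · r ≡ suc d · r + d · r
    expand = solve-∀
    Δr≤ds : suc d · r ≤ d · s
    -- One `s` is cancelled from `Δ r + s ≤ Δ s`, where `Δ = suc d`.
    Δr≤ds = +-cancelˡ-≤ s _ _ (subst (_≤ s + d · s) (+-comm (suc d · r) s)
      (Δ*atRisk+saturated≤Δ*saturated G M regular))

  -- The condition on `N` reads `(Δ - 1) N < (2Δ - 1) 2^Δ`; it forces fewer than `2^Δ` at-risk
  -- vertices for the minimum maximal matching supplied by `edgeDominationNumber`.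
  small⇒γ≤γₑ : ∀ d {N} → d · N < (d + suc (d + 0)) · 2 ^ suc d →
               Regular G (suc d) → n ≤ N → γ G ≤ γₑ G
  small⇒γ≤γₑ d {N} dN< regular n≤N =
    let M , maximal , ∣M∣≡γₑ = proj₁ (proj₂ (edgeDominationNumber G)) in
    few-atRisk⇒γ≤γₑ G M regular (maximal , ∣M∣≡γₑ) (<⇒≤pred (*-cancelˡ-< (d + suc (d + 0)) _ _
      (begin-strict
        (d + suc (d + 0)) · atRiskCount G M   ≤⟨ [2Δ-1]*atRisk≤[Δ-1]*n regular M ⟩
        d · n                                 ≤⟨ *-monoʳ-≤ d n≤N ⟩
        d · N                                 <⟨ dN< ⟩
        (d + suc (d + 0)) · 2 ^ suc d         ∎)))
    where open ≤-Reasoning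

m*n≤o⇒n≤o/m : ∀ m .{{_ : NonZero m}} {n o} → m · n ≤ o → n ≤ o /ⁿ m
m*n≤o⇒n≤o/m m {n} {o} mn≤o = begin
  n              ≡⟨ m*n/n≡m n m ⟨
  n · m /ⁿ m     ≡⟨ cong (_/ⁿ m) (*-comm n m) ⟩
  m · n /ⁿ m     ≤⟨ /-monoˡ-≤ m mn≤o ⟩
  o /ⁿ m         ∎
  where open ≤-Reasoning

-- The bound with integer division, and the theorem.

open import Data.Integer using (+_; +≤+; 1ℤ; -1ℤ; _*_; _-_) renaming (_≤_ to _≤ᶻ_)
open import Data.Integer.DivMod using (_/_; _/ℕ_; [n/d]*d≤n; div-pos-is-/ℕ)

atRisk-bound : ∀ {n} (G : Graph n) Δ → Regular G Δ → ∀ M →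
  + atRiskCount G M ≤ᶻ _/_ ((+ Δ - 1ℤ) * + n) (+ 2 * + Δ - 1ℤ) {{2Δ-1-nonZero Δ}}
atRisk-bound {n} G zero    regular M = ℤ.≤-trans
  (+≤+ (m+n≤o⇒m≤o _ (atRisk+saturated≤n G M)))
  -- For `Δ = 0` the quotient `q` of `-n` by `-1` satisfies `q * -1 ≤ -n`; cancelling the negative
  -- factor reverses this to `n ≤ q`, and there are at most `n` at-risk vertices.
  (ℤ.*-cancelʳ-≤-neg _ _ -1ℤ (ℤ.≤-trans ([n/d]*d≤n (-1ℤ * + n) -1ℤ) (ℤ.≤-reflexive (ℤ.*-comm -1ℤ (+ n)))))
atRisk-bound {n} G (suc d) regular M = begin
  + atRiskCount G M                         ≤⟨ +≤+ (m*n≤o⇒n≤o/m k ([2Δ-1]*atRisk≤[Δ-1]*n G regular M)) ⟩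
  + (d · n) /ℕ k                            ≡⟨ cong (_/ℕ k) (ℤ.pos-* d n) ⟩
  (+ d * + n) /ℕ k                          ≡⟨ div-pos-is-/ℕ (+ d * + n) k ⟨
  (+ d * + n) / + k                         ∎
  where
  open ℤ.≤-Reasoning
  k = d + suc (d + 0)
  instance
    k-nonZero : NonZero k
    k-nonZero = 2Δ-1-nonZero (suc d)

proposition9 : (∀ {n} (G : Graph n) (Δ : ℕ) → Regular G Δ →
    (∀ M → MinimumMaximalMatching G M →
    + atRiskCount G M ≤ᶻ _/_ ((+ Δ - 1ℤ) * + n) (+ 2 * + Δ - 1ℤ) {{2Δ-1-nonZero Δ}})
    × ((∃ λ M → MinimumMaximalMatching G M × atRiskCount G M ≤ 2 ^ Δ ∸ 1) →
    γ G ≤ γₑ G))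
    × (∀ {n} (G : Graph n) → Regular G 4 → n ≤ 37 → γ G ≤ γₑ G)
    × (∀ {n} (G : Graph n) → Regular G 5 → n ≤ 70 → γ G ≤ γₑ G)
    × (∀ {n} (G : Graph n) → Regular G 6 → n ≤ 140 → γ G ≤ γₑ G)
proposition9 =
    (λ G Δ regular → (λ M _ → atRisk-bound G Δ regular M)
                   , (λ (M , minimum , few) → few-atRisk⇒γ≤γₑ G M regular minimum few))
  -- The three comparisons are `3 * 37 < 7 * 2^4`, `4 * 70 < 9 * 2^5` and `5 * 140 < 11 * 2^6`.
  , (λ G → small⇒γ≤γₑ G 3 (from-yes (111 <? 112)))
  , (λ G → small⇒γ≤γₑ G 4 (from-yes (280 <? 288)))
  , (λ G → small⇒γ≤γₑ G 5 (from-yes (700 <? 704)))
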